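{- Suppose that there are two targets $t_1,t_2$ and let $p_1=p_2=\frac12$. Then any deterministic (possibly adaptive) algorithm needs in the worst case at least $\frac{n}{2}-1$ queries to detect one of the two targets, even when the graph is an unweighted cycle with $n$ vertices.
   Context: Graphs $G=(V,E)$, $|V|=n$, are connected, simple, undirected, with positive edge weights $w$ (unweighted: all weights $1$); $d$ is the shortest-path distance, and $N(v)$ is the set of neighbors of $v$. For $u\in N(v)$, $N(v,u)=\{x\in V: d(v,x)=w(vu)+d(u,x)\}$. The unknown (distinct) targets $t_1,t_2\in V$ are placed by an adversary. A direction query at $v$ independently directs with probability $p_i$ to $t_i$, in which case it returns a neighbor $u\in N(v)$ with $t_i\in N(v,u)$ (possibly chosen adversarially if there are several), without disclosing $i$; if $v=t_i$ this is revealed by the query with probability $p_i$. To detect a target means to determine with certainty some vertex that is a target. -}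

module Defs where

open import Data.Nat using (ℕ; zero; suc; _≤_; _<_; s≤s)
open import Data.Nat.Properties using (1+n≢n; ≤-refl; <-trans)
open import Data.Fin using (Fin; zero; suc; toℕ; fromℕ<)
open import Data.Fin.Properties using (toℕ-fromℕ<; toℕ<n) renaming (_≟_ to _≟ᶠ_)
open import Data.List using (List; []; _∷_)
open import Data.Vec using (Vec; []; _∷_)
open import Data.Product using (∃-syntax; _×_; _,_; proj₂)
open import Data.Rational using (ℚ; 0ℚ; 1ℚ; ½) renaming (_+_ to _+ℚ_; _*_ to _*ℚ_; _<_ to _<ℚ_)
open import Data.Sum using (_⊎_; inj₁; inj₂; swap)
open import Relation.Nullary using (¬_; yes; no)
open import Relation.Nullary.Decidable using (map′)
open import Relation.Binary.Definitions using (DecidableEquality)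
open import Relation.Binary.PropositionalEquality using (_≡_; _≢_; refl; sym; trans; cong; subst)

data Walk {V : Set} (Adj : V → V → Set) : V → V → ℕ → Set where
  []  : ∀ {u} → Walk Adj u u 0
  _∷_ : ∀ {u v x ℓ} → Adj u v → Walk Adj v x ℓ → Walk Adj u x (suc ℓ)

record Graph (n : ℕ) : Set₁ where
  field
    Adj       : Fin n → Fin n → Set
    irrefl    : ∀ {u} → ¬ Adj u u
    symmetric : ∀ {u v} → Adj u v → Adj v u
    connected : ∀ u v → ∃[ ℓ ] Walk Adj u v ℓ

  Distance : Fin n → Fin n → ℕ → Set
  Distance u v d = Walk Adj u v d × (∀ {ℓ} → Walk Adj u v ℓ → d ≤ ℓ)

  -- x ∈ N(v,u), where every edge has weight 1.
  InN : (v u x : Fin n) → Set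
  InN v u x = Adj v u × ∃[ d ] (Distance u x d × Distance v x (suc d))

data Response (n : ℕ) : Set where
  found   : Response n
  towards : Fin n → Response n

_≟ᴿ_ : ∀ {n} → DecidableEquality (Response n)
found     ≟ᴿ found     = yes refl
found     ≟ᴿ towards _ = no λ ()
towards _ ≟ᴿ found     = no λ ()
towards u ≟ᴿ towards v = map′ (cong towards) (λ { refl → refl }) (u ≟ᶠ v)

-- Most recent query first. The index of the target that produced a response is
-- not recorded.
History : ℕ → Set
History n = List (Fin n × Response n)

-- The next vertex to query is a function of everything seen so far.
Algorithm : ℕ → Set
Algorithm n = History n → Fin n

-- The responses are also listed with the most recent one first.
transcript : ∀ {n q} → Algorithm n → Vec (Response n) q → History n
transcript A []       = []
transcript A (r ∷ rs) = (A (transcript A rs) , r) ∷ transcript A rs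

module _ {n : ℕ} (G : Graph n) where
  open Graph G

  -- Valid t v r : r is a correct response for the target t to a query at v.
  -- (towards is impossible for t ≡ v, as v is at distance 0 from itself.)
  data Valid (t v : Fin n) : Response n → Set where
    found   : t ≡ v → Valid t v found
    towards : ∀ {u} → InN v u t → Valid t v (towards u)

  record Adversary : Set where
    field
      target   : Fin 2 → Fin n
      distinct : target zero ≢ target (suc zero)
      -- The response given to a query at v after a history, if target i is the
      -- one selected; it fixes which u is returned when several are possible.
      answer   : History n → Fin n → Fin 2 → Response n
      valid    : ∀ h v i → Valid (target i) v (answer h v i)

  module _ (p : Fin 2 → ℚ) where

    responsePr : Adversary → History n → Fin n → Response n → ℚ
    responsePr adv h v r = weight zero +ℚ weight (suc zero)
      where
      weight : Fin 2 → ℚ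
      weight i with Adversary.answer adv h v i ≟ᴿ r
      ... | yes _ = p i
      ... | no  _ = 0ℚ

    -- Probability that the queries in h receive the responses in h.
    historyPr : Adversary → History n → ℚ
    historyPr adv []            = 1ℚ
    historyPr adv ((v , r) ∷ h) = responsePr adv h v r *ℚ historyPr adv h

    -- Certainty: some vertex is a target in every instance under which h can
    -- occur.
    Detected : History n → Set
    Detected h = ∃[ x ] (∀ adv → 0ℚ <ℚ historyPr adv h →
                         ∃[ i ] (Adversary.target adv i ≡ x))

fair : Fin 2 → ℚ
fair _ = ½

module _ (n : ℕ) where

  Next : Fin n → Fin n → Set
  Next u v = toℕ v ≡ suc (toℕ u) ⊎ (suc (toℕ u) ≡ n × toℕ v ≡ 0)

  CycleAdj : Fin n → Fin n → Set
  CycleAdj u v = Next u v ⊎ Next v u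

private
  module _ {V : Set} {Adj : V → V → Set} where

    append : ∀ {u v x k ℓ} → Walk Adj u v k → Walk Adj v x ℓ → ∃[ m ] Walk Adj u x m
    append []      w′ = _ , w′
    append (e ∷ w) w′ with append w w′
    ... | _ , w″ = _ , e ∷ w″

    reverse : (∀ {u v} → Adj u v → Adj v u) →
              ∀ {u v k} → Walk Adj u v k → ∃[ m ] Walk Adj v u m
    reverse s []      = _ , []
    reverse s (e ∷ w) with reverse s w
    ... | _ , w′ = append w′ (s e ∷ [])

  next-irrefl : ∀ {n} → 3 ≤ n → {u : Fin n} → ¬ Next n u u
  next-irrefl _ (inj₁ e)       = 1+n≢n (sym e)
  next-irrefl (s≤s (s≤s _)) (inj₂ (e , z)) with trans (sym e) (cong suc z)
  ... | ()

  to-zero : ∀ {n} k (u : Fin (suc n)) → toℕ u ≡ k → ∃[ ℓ ] Walk (CycleAdj (suc n)) u zero ℓ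
  to-zero zero    zero    _ = _ , []
  to-zero {n} (suc k) u   e = _ , step ∷ walk
    where
    k<n : k < suc n
    k<n = <-trans ≤-refl (subst (_< suc n) e (toℕ<n u))
    u⁻ : Fin (suc n)
    u⁻ = fromℕ< k<n
    step : CycleAdj (suc n) u u⁻
    step = inj₂ (inj₁ (trans e (cong suc (sym (toℕ-fromℕ< k<n)))))
    rest : ∃[ ℓ ] Walk (CycleAdj (suc n)) u⁻ zero ℓ
    rest = to-zero k u⁻ (toℕ-fromℕ< k<n)
    walk = proj₂ rest

  cycle-connected : ∀ n (u v : Fin n) → ∃[ ℓ ] Walk (CycleAdj n) u v ℓ
  cycle-connected (suc n) u v with to-zero _ u refl | to-zero _ v refl
  ... | _ , w | _ , w′ with reverse swap w′
  ... | _ , w″ = append w w″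

Cycle : (n : ℕ) → 3 ≤ n → Graph n
Cycle n 3≤n = record
  { Adj       = CycleAdj n
  ; irrefl    = λ { (inj₁ e) → next-irrefl 3≤n e ; (inj₂ e) → next-irrefl 3≤n e }
  ; symmetric = swap
  ; connected = cycle-connected n
  }

module Submission where

-- The adversary uses a pair of (nearly) antipodal targets t and t ⊕ r, where
-- t ⊕ k is the vertex k steps clockwise from t and r = ⌊ n /2⌋. For a target
-- from 1 up to r clockwise steps ahead of the queried vertex the adversary
-- answers with the clockwise neighbour, and for one further ahead with the
-- counterclockwise neighbour, which is correct (respond-valid); a query at
-- the target finds it. Since r is half of n, rounded down, every vertex v
-- other than t and t ⊕ r has one of the two targets ahead of it within r
-- clockwise steps (near-one-of-pair), so "clockwise" is an answer of positive
-- probability to every query which misses the pair.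
--
-- Hence the transcript in which each query is answered clockwise has positive
-- probability for every pair that avoids the queried vertices. A vertex v lies
-- in the pair of t only if t is v or the vertex r steps before v, so k vertices
-- spoil at most 2k choices of t. After q queries with 2q + 2 < n one can thus
-- avoid, along with the queried vertices, any further vertex x
-- (pair-avoiding); then x is not a target, and it cannot be announced with
-- certainty.
--
-- The adversary has to serve all q simultaneously. It is chosen for the largest
-- q satisfying the bound, as the transcripts for smaller q are initial parts of
-- the one for this q.

open import Data.Integer using (+_)
open import Data.Nat using (ℕ; _≤_)
open import Data.Product using (∃; _×_)
open import Data.Rational using (0ℚ; 1ℚ; _/_; _-_) renaming (_<_ to _<ℚ_)
open import Data.Vec using (Vec)
open import Relation.Nullary using (¬_)
open import Defs

open import Data.Fin using (Fin; zero; suc; toℕ)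
open import Data.Fin.Properties using (_≟_; toℕ<n; toℕ-injective; toℕ-fromℕ<; injective⇒≤; ¬∀⟶∃¬)
import Data.Integer as ℤ
import Data.Integer.Properties as ℤ
open import Data.Integer.Tactic.RingSolver using (solve-∀)
open import Data.List using (List; []; _∷_; _++_; length; map; lookup)
open import Data.List.Membership.Propositional using (_∈_; _∉_)
open import Data.List.Membership.Propositional.Properties using (∈-++⁺ˡ; ∈-++⁺ʳ; ∈-map⁺)
open import Data.List.Properties using (length-++; length-map)
open import Data.List.Relation.Unary.Any using (here; there; index)
open import Data.List.Relation.Unary.Any.Properties using (lookup-index)
open import Data.Nat using (zero; suc; _+_; _*_; _∸_; _<_; _≤′_; ≤′-refl; ≤′-step; z≤n; s≤s; NonZero; >-nonZero; ⌊_/2⌋; ⌈_/2⌉)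
open import Data.Nat.DivMod using (_mod_; _%_; m≡m%n+[m/n]*n; n%n≡0; m%n%n≡m%n; m%n<n; [m+n]%n≡m%n; m<n⇒m%n≡m; %-distribˡ-+) renaming (_/_ to _div_)
open import Data.Nat.Properties hiding (_≟_)
open import Data.Product using (_,_)
open import Data.Rational using (positive)
import Data.Rational as ℚ
import Data.Rational.Properties as ℚ
import Data.Rational.Unnormalised as ℚᵘ
import Data.Rational.Unnormalised.Properties as ℚᵘ
open import Data.Sum using (_⊎_; inj₁; inj₂)
open import Data.Vec using ([]; _∷_)
open import Relation.Binary.PropositionalEquality using (_≡_; _≢_; refl; sym; trans; cong; subst; module ≡-Reasoning)
open import Relation.Nullary using (Dec; yes; no; contradiction)
import Data.List.Membership.DecPropositional as DecMembership

-- Arithmetic and counting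

2q+2<n : ∀ n q → (+ q / 1) <ℚ ((+ n / 2) - 1ℚ) → q + q + 2 < n
2q+2<n n q q<n/2-1 = ℤ.drop‿+<+ (rewrite< lhs rhs (ℤ.+-monoˡ-< (+ 2) (ℚᵘ.drop-*<* unnormalised)))
  where
  unnormalised : ℚᵘ.mkℚᵘ (+ q) 0 ℚᵘ.< ℚᵘ.mkℚᵘ (+ n) 1 ℚᵘ.+ (ℚᵘ.- ℚᵘ.1ℚᵘ)
  unnormalised =
    ℚᵘ.<-respˡ-≃ (ℚ.toℚᵘ-fromℚᵘ (ℚᵘ.mkℚᵘ (+ q) 0))
      (ℚᵘ.<-respʳ-≃
        (ℚᵘ.≃-trans (ℚ.toℚᵘ-homo-+ (+ n / 2) (ℚ.- 1ℚ))
                    (ℚᵘ.+-congˡ _ (ℚ.toℚᵘ-fromℚᵘ (ℚᵘ.mkℚᵘ (+ n) 1))))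
        (ℚ.toℚᵘ-mono-< q<n/2-1))
  rewrite< : ∀ {i j k l} → i ≡ j → k ≡ l → i ℤ.< k → j ℤ.< l
  rewrite< refl refl i<k = i<k
  double : ∀ i → i ℤ.* + 2 ℤ.+ + 2 ≡ i ℤ.+ i ℤ.+ + 2
  double = solve-∀
  lhs : + q ℤ.* + 2 ℤ.+ + 2 ≡ + (q + q + 2)
  lhs = double (+ q)
  cancel : ∀ i → (i ℤ.* + 1 ℤ.+ ℤ.- (+ 1) ℤ.* + 2) ℤ.* + 1 ℤ.+ + 2 ≡ i
  cancel = solve-∀
  rhs : (+ n ℤ.* + 1 ℤ.+ ℤ.- (+ 1) ℤ.* + 2) ℤ.* + 1 ℤ.+ + 2 ≡ + n
  rhs = cancel (+ n)

*-positive : ∀ {p q} → 0ℚ <ℚ p → 0ℚ <ℚ q → 0ℚ <ℚ p ℚ.* q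
*-positive {p} {q} 0<p 0<q = ℚ.positive⁻¹ _ {{ℚ.pos*pos⇒pos p {{positive 0<p}} q {{positive 0<q}}}}

half+half≤n : ∀ n → ⌊ n /2⌋ + ⌊ n /2⌋ ≤ n
half+half≤n n = begin
  ⌊ n /2⌋ + ⌊ n /2⌋  ≤⟨ +-monoʳ-≤ ⌊ n /2⌋ (⌊n/2⌋≤⌈n/2⌉ n) ⟩
  ⌊ n /2⌋ + ⌈ n /2⌉  ≡⟨ ⌊n/2⌋+⌈n/2⌉≡n n ⟩
  n                  ∎
  where open ≤-Reasoning

n≤1+half+half : ∀ n → n ≤ suc (⌊ n /2⌋ + ⌊ n /2⌋)
n≤1+half+half n = begin
  n                        ≡⟨ ⌊n/2⌋+⌈n/2⌉≡n n ⟨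
  ⌊ n /2⌋ + ⌈ n /2⌉        ≤⟨ +-monoʳ-≤ ⌊ n /2⌋ (⌊n/2⌋-mono (n≤1+n (suc n))) ⟩
  ⌊ n /2⌋ + suc ⌊ n /2⌋    ≡⟨ +-suc ⌊ n /2⌋ ⌊ n /2⌋ ⟩
  suc (⌊ n /2⌋ + ⌊ n /2⌋)  ∎
  where open ≤-Reasoning

vertex-avoiding : ∀ {n} (vs : List (Fin n)) → length vs < n → ∃ λ t → t ∉ vs
vertex-avoiding {n} vs len<n = ¬∀⟶∃¬ n (_∈ vs) (_∈? vs) λ all∈ →
  <⇒≱ len<n (injective⇒≤ {f = λ t → index (all∈ t)} λ {t} {u} same →
    trans (lookup-index (all∈ t)) (trans (cong (lookup vs) same) (sym (lookup-index (all∈ u)))))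
  where open DecMembership (_≟_ {n}) using (_∈?_)

-- Rotations of the cycle

module _ {n : ℕ} .{{_ : NonZero n}} where

  infixl 6 _⊕_

  -- The vertex k steps clockwise from v, the successor of Next being one step.
  _⊕_ : Fin n → ℕ → Fin n
  v ⊕ k = (toℕ v + k) mod n

  toℕ-⊕ : ∀ v k → toℕ (v ⊕ k) ≡ (toℕ v + k) % n
  toℕ-⊕ v k = toℕ-fromℕ< (m%n<n (toℕ v + k) n)

  [m%n+k]%n≡[m+k]%n : ∀ m k → (m % n + k) % n ≡ (m + k) % n
  [m%n+k]%n≡[m+k]%n m k = begin
    (m % n + k) % n          ≡⟨ %-distribˡ-+ (m % n) k n ⟩
    (m % n % n + k % n) % n  ≡⟨ cong (λ a → (a + k % n) % n) (m%n%n≡m%n m n) ⟩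
    (m % n + k % n) % n      ≡⟨ %-distribˡ-+ m k n ⟨
    (m + k) % n              ∎
    where open ≡-Reasoning

  ⊕-⊕ : ∀ v j k → v ⊕ j ⊕ k ≡ v ⊕ (j + k)
  ⊕-⊕ v j k = toℕ-injective (begin
    toℕ (v ⊕ j ⊕ k)            ≡⟨ toℕ-⊕ (v ⊕ j) k ⟩
    (toℕ (v ⊕ j) + k) % n      ≡⟨ cong (λ a → (a + k) % n) (toℕ-⊕ v j) ⟩
    ((toℕ v + j) % n + k) % n  ≡⟨ [m%n+k]%n≡[m+k]%n (toℕ v + j) k ⟩
    (toℕ v + j + k) % n        ≡⟨ cong (_% n) (+-assoc (toℕ v) j k) ⟩
    (toℕ v + (j + k)) % n      ≡⟨ toℕ-⊕ v (j + k) ⟨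
    toℕ (v ⊕ (j + k))          ∎)
    where open ≡-Reasoning

  ⊕-0 : ∀ v → v ⊕ 0 ≡ v
  ⊕-0 v = toℕ-injective (begin
    toℕ (v ⊕ 0)      ≡⟨ toℕ-⊕ v 0 ⟩
    (toℕ v + 0) % n  ≡⟨ cong (_% n) (+-identityʳ (toℕ v)) ⟩
    toℕ v % n        ≡⟨ m<n⇒m%n≡m (toℕ<n v) ⟩
    toℕ v            ∎)
    where open ≡-Reasoning

  ⊕-n : ∀ v → v ⊕ n ≡ v
  ⊕-n v = toℕ-injective (begin
    toℕ (v ⊕ n)      ≡⟨ toℕ-⊕ v n ⟩
    (toℕ v + n) % n  ≡⟨ [m+n]%n≡m%n (toℕ v) n ⟩
    toℕ v % n        ≡⟨ m<n⇒m%n≡m (toℕ<n v) ⟩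
    toℕ v            ∎)
    where open ≡-Reasoning

  ⊕-suc : ∀ v k → v ⊕ suc k ≡ v ⊕ k ⊕ 1
  ⊕-suc v k = sym (trans (⊕-⊕ v k 1) (cong (v ⊕_) (+-comm k 1)))

  -- A rotation with a fixed point is by a multiple of n.
  ⊕-fixed : ∀ v k → v ⊕ k ≡ v → k ≡ 0 ⊎ n ≤ k
  ⊕-fixed v k v⊕k≡v = multiple ((toℕ v + k) div n) (+-cancelˡ-≡ (toℕ v) _ _ (begin
    toℕ v + k                                    ≡⟨ m≡m%n+[m/n]*n (toℕ v + k) n ⟩
    (toℕ v + k) % n + (toℕ v + k) div n * n      ≡⟨ cong (_+ (toℕ v + k) div n * n) (toℕ-⊕ v k) ⟨
    toℕ (v ⊕ k) + (toℕ v + k) div n * n          ≡⟨ cong (λ u → toℕ u + (toℕ v + k) div n * n) v⊕k≡v ⟩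
    toℕ v + (toℕ v + k) div n * n                ∎))
    where
    open ≡-Reasoning
    multiple : ∀ a → k ≡ a * n → k ≡ 0 ⊎ n ≤ k
    multiple zero    k≡0 = inj₁ k≡0
    multiple (suc a) k≡n+an = inj₂ (≤-trans (m≤m+n n (a * n)) (≤-reflexive (sym k≡n+an)))

  rotation-transitive : ∀ v x → ∃ λ k → k < n × v ⊕ k ≡ x
  rotation-transitive v x = k , m%n<n (toℕ x + (n ∸ toℕ v)) n , toℕ-injective (begin
    toℕ (v ⊕ k)                                ≡⟨ toℕ-⊕ v k ⟩
    (toℕ v + (toℕ x + (n ∸ toℕ v)) % n) % n    ≡⟨ cong (_% n) (+-comm (toℕ v) k) ⟩
    ((toℕ x + (n ∸ toℕ v)) % n + toℕ v) % n    ≡⟨ [m%n+k]%n≡[m+k]%n (toℕ x + (n ∸ toℕ v)) (toℕ v) ⟩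
    (toℕ x + (n ∸ toℕ v) + toℕ v) % n          ≡⟨ cong (_% n) (+-assoc (toℕ x) (n ∸ toℕ v) (toℕ v)) ⟩
    (toℕ x + (n ∸ toℕ v + toℕ v)) % n          ≡⟨ cong (λ a → (toℕ x + a) % n) (m∸n+n≡m (<⇒≤ (toℕ<n v))) ⟩
    (toℕ x + n) % n                            ≡⟨ [m+n]%n≡m%n (toℕ x) n ⟩
    toℕ x % n                                  ≡⟨ m<n⇒m%n≡m (toℕ<n x) ⟩
    toℕ x                                      ∎)
    where
    open ≡-Reasoning
    k : ℕ
    k = (toℕ x + (n ∸ toℕ v)) % n

  next⇒⊕1 : ∀ {u v} → Next n u v → u ⊕ 1 ≡ v
  next⇒⊕1 {u} {v} next = toℕ-injective (trans (toℕ-⊕ u 1) (trans (cong (_% n) (+-comm (toℕ u) 1)) (wrap next)))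
    where
    wrap : Next n u v → suc (toℕ u) % n ≡ toℕ v
    wrap (inj₁ v≡1+u)         = trans (cong (_% n) (sym v≡1+u)) (m<n⇒m%n≡m (toℕ<n v))
    wrap (inj₂ (1+u≡n , v≡0)) = trans (cong (_% n) 1+u≡n) (trans (n%n≡0 n) (sym v≡0))

  next-⊕1 : ∀ u → Next n u (u ⊕ 1)
  next-⊕1 u with m≤n⇒m<n∨m≡n (toℕ<n u)
  ... | inj₁ 1+u<n = inj₁ (trans (toℕ-⊕ u 1) (trans (cong (_% n) (+-comm (toℕ u) 1)) (m<n⇒m%n≡m 1+u<n)))
  ... | inj₂ 1+u≡n = inj₂ (1+u≡n , trans (toℕ-⊕ u 1) (trans (cong (_% n) (trans (+-comm (toℕ u) 1) 1+u≡n)) (n%n≡0 n)))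

-- Distances in the cycle

  clockwise-walk : ∀ u d → Walk (CycleAdj n) u (u ⊕ d) d
  clockwise-walk u zero    = subst (λ x → Walk (CycleAdj n) u x 0) (sym (⊕-0 u)) []
  clockwise-walk u (suc d) =
    inj₁ (next-⊕1 u) ∷ subst (λ x → Walk (CycleAdj n) (u ⊕ 1) x d) (⊕-⊕ u 1 d) (clockwise-walk (u ⊕ 1) d)

  counterclockwise-walk : ∀ x d → Walk (CycleAdj n) (x ⊕ d) x d
  counterclockwise-walk x zero    = subst (λ u → Walk (CycleAdj n) u x 0) (sym (⊕-0 x)) []
  counterclockwise-walk x (suc d) =
    subst (λ u → CycleAdj n u (x ⊕ d)) (sym (⊕-suc x d)) (inj₂ (next-⊕1 (x ⊕ d))) ∷ counterclockwise-walk x d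

  -- The lower bound behind all distances: for k up to n, a walk from u to u ⊕ k
  -- is at least as long as one of the two arcs, which have lengths k and n ∸ k.
  -- Leaving k unbounded makes the induction on the walk work: one step of the
  -- walk changes k by one, without any reduction modulo n.
  walk-length : ∀ {u x ℓ} → Walk (CycleAdj n) u x ℓ → ∀ k → u ⊕ k ≡ x → k ≤ ℓ ⊎ n ≤ k + ℓ
  walk-length {u} [] k u⊕k≡u with ⊕-fixed u k u⊕k≡u
  ... | inj₁ k≡0 = inj₁ (≤-reflexive k≡0)
  ... | inj₂ n≤k = inj₂ (≤-trans n≤k (m≤m+n k 0))
  walk-length (_∷_ _ _) zero _ = inj₁ z≤n
  walk-length {u} {x} {suc ℓ} (_∷_ {v = v} (inj₁ next) w) (suc k) u⊕1+k≡x with walk-length w k v⊕k≡x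
    where
    v⊕k≡x : v ⊕ k ≡ x
    v⊕k≡x = trans (cong (_⊕ k) (sym (next⇒⊕1 next))) (trans (⊕-⊕ u 1 k) u⊕1+k≡x)
  ... | inj₁ k≤ℓ   = inj₁ (s≤s k≤ℓ)
  ... | inj₂ n≤k+ℓ = inj₂ (≤-trans n≤k+ℓ (+-mono-≤ (n≤1+n k) (n≤1+n ℓ)))
  walk-length {u} {x} {suc ℓ} (_∷_ {v = v} (inj₂ next) w) k@(suc _) u⊕k≡x with walk-length w (suc k) v⊕1+k≡x
    where
    v⊕1+k≡x : v ⊕ suc k ≡ x
    v⊕1+k≡x = trans (sym (⊕-⊕ v 1 k)) (trans (cong (_⊕ k) (next⇒⊕1 next)) u⊕k≡x)
  ... | inj₁ 1+k≤ℓ   = inj₁ (≤-trans (n≤1+n k) (m≤n⇒m≤1+n 1+k≤ℓ))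
  ... | inj₂ n≤1+k+ℓ = inj₂ (≤-trans n≤1+k+ℓ (≤-reflexive (sym (+-suc k ℓ))))

  module _ (3≤n : 3 ≤ n) where

    open Graph (Cycle n 3≤n) using (Distance; InN)

    clockwise-distance : ∀ u d → d + d ≤ n → Distance u (u ⊕ d) d
    clockwise-distance u d 2d≤n = clockwise-walk u d , λ w → shortest (walk-length w d refl)
      where
      shortest : ∀ {ℓ} → d ≤ ℓ ⊎ n ≤ d + ℓ → d ≤ ℓ
      shortest (inj₁ d≤ℓ)   = d≤ℓ
      shortest (inj₂ n≤d+ℓ) = +-cancelˡ-≤ d _ _ (≤-trans 2d≤n n≤d+ℓ)

    counterclockwise-distance : ∀ x d → d + d ≤ n → Distance (x ⊕ d) x d
    counterclockwise-distance x d 2d≤n = counterclockwise-walk x d , λ w → shortest (walk-length w (n ∸ d) return)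
      where
      d≤n : d ≤ n
      d≤n = ≤-trans (m≤m+n d d) 2d≤n
      return : x ⊕ d ⊕ (n ∸ d) ≡ x
      return = trans (⊕-⊕ x d (n ∸ d)) (trans (cong (x ⊕_) (m+[n∸m]≡n d≤n)) (⊕-n x))
      shortest : ∀ {ℓ} → n ∸ d ≤ ℓ ⊎ n ≤ n ∸ d + ℓ → d ≤ ℓ
      shortest (inj₁ n∸d≤ℓ)     = ≤-trans (m+n≤o⇒m≤o∸n d 2d≤n) n∸d≤ℓ
      shortest {ℓ} (inj₂ n≤n∸d+ℓ) =
        +-cancelˡ-≤ (n ∸ d) d ℓ (≤-trans (≤-reflexive (m∸n+n≡m d≤n)) n≤n∸d+ℓ)

    clockwise-InN : ∀ v d → suc d + suc d ≤ n → InN v (v ⊕ 1) (v ⊕ suc d)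
    clockwise-InN v d 2+2d≤n =
      inj₁ (next-⊕1 v) , d ,
      subst (λ x → Distance (v ⊕ 1) x d) (⊕-⊕ v 1 d)
        (clockwise-distance (v ⊕ 1) d (≤-trans (+-mono-≤ (n≤1+n d) (n≤1+n d)) 2+2d≤n)) ,
      clockwise-distance v (suc d) 2+2d≤n

    counterclockwise-InN : ∀ x d → suc d + suc d ≤ n → InN (x ⊕ suc d) (x ⊕ d) x
    counterclockwise-InN x d 2+2d≤n =
      subst (λ u → CycleAdj n u (x ⊕ d)) (sym (⊕-suc x d)) (inj₂ (next-⊕1 (x ⊕ d))) , d ,
      counterclockwise-distance x d (≤-trans (+-mono-≤ (n≤1+n d) (n≤1+n d)) 2+2d≤n) ,
      counterclockwise-distance x (suc d) 2+2d≤n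

-- Answers to queries

module _ (n : ℕ) (3≤n : 3 ≤ n) where

  private
    instance
      n≢0 : NonZero n
      n≢0 = >-nonZero (≤-trans (s≤s z≤n) 3≤n)

    r : ℕ
    r = ⌊ n /2⌋

  open Graph (Cycle n 3≤n) using (InN)

  -- Some number of clockwise steps from 1 to r leads from v to x.
  Near : Fin n → Fin n → Set
  Near v x = ∃ λ d → d < r × v ⊕ suc d ≡ x

  near? : ∀ v x → Dec (Near v x)
  near? v x = anyUpTo? (λ d → v ⊕ suc d ≟ x) r

  within-half : ∀ {d} → d < r → suc d + suc d ≤ n
  within-half d<r = ≤-trans (+-mono-≤ d<r d<r) (half+half≤n n)

  -- The answer for target x to a query at v. For even n an antipodal target can
  -- be reached both ways, and this tie is broken clockwise; v ⊕ (n ∸ 1) is the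
  -- counterclockwise neighbour of v.
  respond : Fin n → Fin n → Response n
  respond x v with near? v x | x ≟ v
  ... | yes _ | _     = towards (v ⊕ 1)
  ... | no _  | yes _ = found
  ... | no _  | no _  = towards (v ⊕ (n ∸ 1))

  respond-near : ∀ {x v} → Near v x → respond x v ≡ towards (v ⊕ 1)
  respond-near {x} {v} near with near? v x | x ≟ v
  ... | yes _    | _ = refl
  ... | no ¬near | _ = contradiction near ¬near

  far-InN : ∀ {x v} → ¬ Near v x → x ≢ v → InN v (v ⊕ (n ∸ 1)) x
  far-InN {x} {v} ¬near x≢v with rotation-transitive x v
  ... | zero  , _   , x⊕0≡v = contradiction (trans (sym (⊕-0 x)) x⊕0≡v) x≢v
  ... | suc e , e<n , refl  =
    subst (λ u → InN (x ⊕ suc e) u x) x⊕e≡v⊕[n∸1] (counterclockwise-InN 3≤n x e 2+2e≤n)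
    where
    x⊕e≡v⊕[n∸1] : x ⊕ e ≡ x ⊕ suc e ⊕ (n ∸ 1)
    x⊕e≡v⊕[n∸1] = begin
      x ⊕ e                    ≡⟨ ⊕-n (x ⊕ e) ⟨
      x ⊕ e ⊕ n                ≡⟨ cong (x ⊕ e ⊕_) (m+[n∸m]≡n (≤-trans (s≤s z≤n) 3≤n)) ⟨
      x ⊕ e ⊕ (1 + (n ∸ 1))    ≡⟨ ⊕-⊕ (x ⊕ e) 1 (n ∸ 1) ⟨
      x ⊕ e ⊕ 1 ⊕ (n ∸ 1)      ≡⟨ cong (_⊕ (n ∸ 1)) (⊕-suc x e) ⟨
      x ⊕ suc e ⊕ (n ∸ 1)      ∎
      where open ≡-Reasoning
    -- The complementary clockwise distance from v to x.
    c : ℕ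
    c = n ∸ suc e
    back : x ⊕ suc e ⊕ c ≡ x
    back = trans (⊕-⊕ x (suc e) c) (trans (cong (x ⊕_) (m+[n∸m]≡n (<⇒≤ e<n))) (⊕-n x))
    r<c : ∀ c → 0 < c → x ⊕ suc e ⊕ c ≡ x → r < c
    r<c (suc d) _ back with d <? r
    ... | yes d<r = contradiction (d , d<r , back) ¬near
    ... | no d≮r  = s≤s (≮⇒≥ d≮r)
    2+2e≤n : suc e + suc e ≤ n
    2+2e≤n = ≤-trans (+-mono-≤ 1+e≤r 1+e≤r) (half+half≤n n)
      where
      1+e≤r : suc e ≤ r
      1+e≤r = +-cancelʳ-≤ (suc r) (suc e) r (begin
        suc e + suc r  ≤⟨ +-monoʳ-≤ (suc e) (r<c c (m<n⇒0<n∸m e<n) back) ⟩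
        suc e + c      ≡⟨ m+[n∸m]≡n (<⇒≤ e<n) ⟩
        n              ≤⟨ n≤1+half+half n ⟩
        suc (r + r)    ≡⟨ +-suc r r ⟨
        r + suc r      ∎)
        where open ≤-Reasoning

  respond-valid : ∀ x v → Valid (Cycle n 3≤n) x v (respond x v)
  respond-valid x v with near? v x | x ≟ v
  ... | yes (d , d<r , refl) | _       = towards (clockwise-InN 3≤n v d (within-half d<r))
  ... | no _                 | yes x≡v = found x≡v
  ... | no ¬near             | no x≢v  = towards (far-InN ¬near x≢v)

-- Antipodal pairs of targets

  0<r : 0 < r
  0<r = ⌊n/2⌋-mono (≤-trans (s≤s (s≤s z≤n)) 3≤n)

  t≢t⊕r : (t : Fin n) → t ≢ t ⊕ r
  t≢t⊕r t t≡t⊕r with ⊕-fixed t r (sym t≡t⊕r)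
  ... | inj₁ r≡0 = >⇒≢ 0<r r≡0
  ... | inj₂ n≤r = <⇒≱ r<n n≤r
    where
    r<n : r < n
    r<n = ≤-trans (+-monoˡ-≤ r 0<r) (half+half≤n n)

  -- The targets t and t ⊕ r.
  pair : Fin n → Fin 2 → Fin n
  pair t zero    = t
  pair t (suc _) = t ⊕ r

  pairAdversary : Fin n → Adversary (Cycle n 3≤n)
  pairAdversary t = record
    { target   = pair t
    ; distinct = t≢t⊕r t
    ; answer   = λ _ v i → respond (pair t i) v
    ; valid    = λ _ v i → respond-valid (pair t i) v
    }

  -- If t is suc d clockwise steps ahead of v with suc d > r, then the way to
  -- t ⊕ r wraps around past v, leaving suc d + r ∸ n < r steps.
  near-one-of-pair : {t v : Fin n} → v ≢ t → v ≢ t ⊕ r → Near v t ⊎ Near v (t ⊕ r)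
  near-one-of-pair {t} {v} v≢t v≢t⊕r with rotation-transitive v t
  ... | zero  , _   , v⊕0≡t = contradiction (trans (sym (⊕-0 v)) v⊕0≡t) v≢t
  ... | suc d , d<n , refl with d <? r
  ...   | yes d<r = inj₁ (d , d<r , refl)
  ...   | no d≮r  = inj₂ (wrapped (suc d + r ∸ n) e<r v⊕e≡t⊕r)
    where
    n≤1+d+r : n ≤ suc d + r
    n≤1+d+r = ≤-trans (n≤1+half+half n) (s≤s (+-monoˡ-≤ r (≮⇒≥ d≮r)))
    e<r : suc d + r ∸ n < r
    e<r = +-cancelˡ-< n _ _ (begin-strict
      n + (suc d + r ∸ n)  ≡⟨ m+[n∸m]≡n n≤1+d+r ⟩
      suc d + r            <⟨ +-monoˡ-< r d<n ⟩
      n + r                ∎)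
      where open ≤-Reasoning
    v⊕e≡t⊕r : v ⊕ (suc d + r ∸ n) ≡ v ⊕ suc d ⊕ r
    v⊕e≡t⊕r = begin
      v ⊕ (suc d + r ∸ n)        ≡⟨ cong (_⊕ (suc d + r ∸ n)) (⊕-n v) ⟨
      v ⊕ n ⊕ (suc d + r ∸ n)    ≡⟨ ⊕-⊕ v n (suc d + r ∸ n) ⟩
      v ⊕ (n + (suc d + r ∸ n))  ≡⟨ cong (v ⊕_) (m+[n∸m]≡n n≤1+d+r) ⟩
      v ⊕ (suc d + r)            ≡⟨ ⊕-⊕ v (suc d) r ⟨
      v ⊕ suc d ⊕ r              ∎
      where open ≡-Reasoning
    wrapped : ∀ e → e < r → v ⊕ e ≡ v ⊕ suc d ⊕ r → Near v (v ⊕ suc d ⊕ r)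
    wrapped zero    _   v⊕0≡t⊕r = contradiction (trans (sym (⊕-0 v)) v⊕0≡t⊕r) v≢t⊕r
    wrapped (suc e) e<r v⊕e≡t⊕r = e , <⇒≤ e<r , v⊕e≡t⊕r

  -- Besides vs itself, t has to avoid the vertices r steps before those of vs;
  -- these are n ∸ r steps after them.
  pair-avoiding : (vs : List (Fin n)) → length vs + length vs < n → ∃ λ t → t ∉ vs × t ⊕ r ∉ vs
  pair-avoiding vs 2len<n with vertex-avoiding (vs ++ map (_⊕ (n ∸ r)) vs) (subst (_< n) (sym len) 2len<n)
    where
    len : length (vs ++ map (_⊕ (n ∸ r)) vs) ≡ length vs + length vs
    len = trans (length-++ vs) (cong (λ l → length vs + l) (length-map (_⊕ (n ∸ r)) vs))
  ... | t , t∉ = t , (λ t∈vs → t∉ (∈-++⁺ˡ t∈vs)) ,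
    λ t⊕r∈vs → t∉ (∈-++⁺ʳ vs (subst (_∈ map (_⊕ (n ∸ r)) vs) return (∈-map⁺ (_⊕ (n ∸ r)) t⊕r∈vs)))
    where
    return : t ⊕ r ⊕ (n ∸ r) ≡ t
    return = trans (⊕-⊕ t r (n ∸ r)) (trans (cong (t ⊕_) (m+[n∸m]≡n (⌊n/2⌋≤n n))) (⊕-n t))

-- The transcript of clockwise answers

  responsePr-positive : ∀ t h {v} → v ≢ t → v ≢ t ⊕ r →
    0ℚ <ℚ responsePr (Cycle n 3≤n) fair (pairAdversary t) h v (towards (v ⊕ 1))
  responsePr-positive t h {v} v≢t v≢t⊕r
    with respond t v ≟ᴿ towards (v ⊕ 1) | respond (t ⊕ r) v ≟ᴿ towards (v ⊕ 1) | near-one-of-pair v≢t v≢t⊕r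
  ... | yes _ | yes _ | _         = ℚ.positive⁻¹ _
  ... | yes _ | no _  | _         = ℚ.positive⁻¹ _
  ... | no _  | yes _ | _         = ℚ.positive⁻¹ _
  ... | no ¬eq | no _  | inj₁ near = contradiction (respond-near near) ¬eq
  ... | no _  | no ¬eq | inj₂ near = contradiction (respond-near near) ¬eq

  module _ (A : Algorithm n) where

    mutual

      -- Each query is answered with its clockwise neighbour, most recent first.
      clockwiseResponses : (q : ℕ) → Vec (Response n) q
      clockwiseResponses zero    = []
      clockwiseResponses (suc q) = towards (query q ⊕ 1) ∷ clockwiseResponses q

      -- The vertex that A queries after q clockwise answers.
      query : ℕ → Fin n
      query q = A (transcript A (clockwiseResponses q))

    -- The first q queries of this run, most recent first.
    queries : ℕ → List (Fin n)
    queries zero    = []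
    queries (suc q) = query q ∷ queries q

    length-queries : ∀ q → length (queries q) ≡ q
    length-queries zero    = refl
    length-queries (suc q) = cong suc (length-queries q)

    queries-mono : ∀ {p q v} → p ≤′ q → v ∈ queries p → v ∈ queries q
    queries-mono ≤′-refl        v∈ = v∈
    queries-mono (≤′-step p≤′q) v∈ = there (queries-mono p≤′q v∈)

    historyPr-positive : ∀ t q → t ∉ queries q → t ⊕ r ∉ queries q →
      0ℚ <ℚ historyPr (Cycle n 3≤n) fair (pairAdversary t) (transcript A (clockwiseResponses q))
    historyPr-positive t zero    _  _    = ℚ.positive⁻¹ 1ℚ
    historyPr-positive t (suc q) t∉ t⊕r∉ = *-positive last earlier
      where
      last = responsePr-positive t (transcript A (clockwiseResponses q))
               (λ v≡t → t∉ (here (sym v≡t))) (λ v≡t⊕r → t⊕r∉ (here (sym v≡t⊕r)))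
      earlier = historyPr-positive t q (λ t∈ → t∉ (there t∈)) (λ t⊕r∈ → t⊕r∉ (there t⊕r∈))

    -- Whatever vertex x is announced, some pair avoiding x still explains the
    -- whole transcript.
    clockwise-undetected : ∀ q → q + q + 2 < n →
      ¬ Detected (Cycle n 3≤n) fair (transcript A (clockwiseResponses q))
    clockwise-undetected q 2q+2<n (x , certain) with pair-avoiding (x ∷ queries q) (subst (_< n) count 2q+2<n)
      where
      count : q + q + 2 ≡ length (x ∷ queries q) + length (x ∷ queries q)
      count = trans (+-comm (q + q) 2) (trans (cong suc (sym (+-suc q q)))
                (sym (cong (λ l → suc l + suc l) (length-queries q))))
    ... | t , t∉ , t⊕r∉
      with certain (pairAdversary t)
             (historyPr-positive t q (λ t∈ → t∉ (there t∈)) (λ t⊕r∈ → t⊕r∉ (there t⊕r∈)))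
    ...   | zero     , t≡x   = t∉ (here t≡x)
    ...   | suc zero , t⊕r≡x = t⊕r∉ (here t⊕r≡x)

corollary1 : (n : ℕ) (3≤n : 3 ≤ n) (A : Algorithm n) →
    ∃ λ (adv : Adversary (Cycle n 3≤n)) →
    (q : ℕ) → (+ q / 1) <ℚ ((+ n / 2) - 1ℚ) →
    ∃ λ (rs : Vec (Response n) q) →
    0ℚ <ℚ historyPr (Cycle n 3≤n) fair adv (transcript A rs) ×
    ¬ Detected (Cycle n 3≤n) fair (transcript A rs)
corollary1 n 3≤n A with pair-avoiding n 3≤n (queries n 3≤n A Q) (subst (_< n) (sym count) 2Q<n)
  where
  -- The largest q with 2q + 2 < n.
  Q : ℕ
  Q = ⌊ n ∸ 3 /2⌋
  count : length (queries n 3≤n A Q) + length (queries n 3≤n A Q) ≡ Q + Q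
  count = cong (λ l → l + l) (length-queries n 3≤n A Q)
  2Q<n : Q + Q < n
  2Q<n = ≤-trans (s≤s (half+half≤n (n ∸ 3))) (∸-monoʳ-< (s≤s z≤n) 3≤n)
... | t , t∉ , t⊕r∉ = pairAdversary n 3≤n t , λ q q<n/2-1 →
  clockwiseResponses n 3≤n A q ,
  historyPr-positive n 3≤n A t q
    (λ t∈ → t∉ (queries-mono n 3≤n A (q≤′Q q (2q+2<n n q q<n/2-1)) t∈))
    (λ t⊕r∈ → t⊕r∉ (queries-mono n 3≤n A (q≤′Q q (2q+2<n n q q<n/2-1)) t⊕r∈)) ,
  clockwise-undetected n 3≤n A q (2q+2<n n q q<n/2-1)
  where
  q≤′Q : ∀ q → q + q + 2 < n → q ≤′ ⌊ n ∸ 3 /2⌋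
  q≤′Q q 2q+3≤n = ≤⇒≤′ (begin
    q               ≡⟨ n≡⌊n+n/2⌋ q ⟩
    ⌊ q + q /2⌋     ≤⟨ ⌊n/2⌋-mono (m+n≤o⇒m≤o∸n (q + q) (≤-trans (≤-reflexive (+-suc (q + q) 2)) 2q+3≤n)) ⟩
    ⌊ n ∸ 3 /2⌋     ∎)
    where open ≤-Reasoning
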